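{- For all $i \in \mathbb{N}$ and real $y\ge 2$, $$ \mathcal{S}_y\subseteq \mathcal{B}_{\theta_l} \subseteq \mathcal{D}^*_{i,y} \subseteq \mathcal{D}_{i,y} \subseteq \mathcal{B}_{\theta_u}, $$ where $$ \theta_l(n) = \max(y, (yn)^{1/i}), \quad \theta_u(n) = y n^{1/i}. $$
   Context: $\mathbb{N}=\{1,2,\ldots\}$. $\mathcal{S}_y$ is the set of natural numbers all of whose prime factors are $\le y$. For a real arithmetic function $\theta$, $\mathcal{B}_\theta$ is the set of positive integers containing $n=1$ and all $n=p_1\cdots p_k$ whose prime factors $p_1\le \cdots \le p_k$ satisfy $p_{j+1} \le \theta ( p_1\cdots p_{j})$ for $0\le j < k$ (the empty product being $1$). A finite increasing sequence of natural numbers is called $y$-dense if the ratios of consecutive terms are all $\le y$. Define $\mathcal{D}_{0,y}=\mathbb{N}$. For $i\ge 1$, $n\in \mathcal{D}_{i,y}$ if and only if the increasing sequence $\{d: d|n,\ d\in \mathcal{D}_{i-1,y}\}$ is a $y$-dense sequence containing $1$ and $n$. Define $\mathcal{D}^*_{0,y}=\mathbb{N}$. For $i\ge 1$, $n\in \mathcal{D}^*_{i,y}$ if and only if for each $j$ with $0\le j \le i-1$, the increasing sequence $\{d: d|n,\ d\in \mathcal{D}^*_{j,y} \text{ and } n/d \in \mathcal{D}^*_{i-1-j,y} \}$ is a $y$-dense sequence containing $1$ and $n$. -}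

module Defs where

import Algebra.Definitions.RawSemiring as RawSemiring
open import Data.Fin.Base using (Fin; toℕ)
open import Data.Integer.Base as ℤ using (-[1+_])
import Data.Integer.Properties as ℤ
open import Data.List.Base using (List; length; lookup; take)
open import Data.List.Relation.Unary.All using (All)
open import Data.Nat.Base as ℕ using (ℕ; zero; suc; z≤n; s≤s)
open import Data.Nat.Coprimality as Coprime using (1-coprimeTo)
open import Data.Nat.Divisibility using (_∣_; quotient)
open import Data.Nat.Induction using (Acc; acc; <-wellFounded)
open import Data.Nat.ListAction using (product)
open import Data.Nat.Primality using (Prime)
import Data.Nat.Properties as ℕ
open import Data.List.Relation.Unary.Sorted.TotalOrder ℕ.≤-totalOrder using (Sorted)
open import Data.Product.Base using (Σ-syntax; ∃; ∃-syntax; _×_; _,_; proj₁; proj₂)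
open import Data.Rational.Base
open import Data.Rational.Properties
open import Data.Rational.Solver using (module +-*-Solver)
open import Data.Sum.Base using (_⊎_; inj₁; inj₂)
open import Function.Base using (_∘_)
open import Function.Bundles using (_⇔_; mk⇔; Equivalence)
open import Level using (0ℓ)
open import Relation.Binary.Definitions using (tri<; tri≈; tri>)
open import Relation.Binary.PropositionalEquality
  using (_≡_; refl; sym; trans; cong; subst)
open import Relation.Nullary using (¬_; yes; no; contradiction)
open import Relation.Unary using (Pred)

private
  variable
    p q r s : ℚ

infixr 8 _^_
_^_ : ℚ → ℕ → ℚ
_^_ = RawSemiring._^_ +-*-rawSemiring

q<q+1 : ∀ q → q < q + 1ℚ
q<q+1 q = subst (_< q + 1ℚ) (+-identityʳ q) (+-monoʳ-< q (positive⁻¹ 1ℚ))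

q-1<q : ∀ q → q - 1ℚ < q
q-1<q q = subst (q - 1ℚ <_) (+-identityʳ q) (+-monoʳ-< q (negative⁻¹ (- 1ℚ)))

*-mono-≤₀ : 0ℚ ≤ p → p ≤ q → 0ℚ ≤ r → r ≤ s → p * r ≤ q * s
*-mono-≤₀ {p} {q} {r} {s} 0≤p p≤q 0≤r r≤s = ≤-trans
  (*-monoʳ-≤-nonNeg r {{nonNegative 0≤r}} p≤q)
  (*-monoˡ-≤-nonNeg q {{nonNegative (≤-trans 0≤p p≤q)}} r≤s)

^-nonNeg : ∀ i → 0ℚ ≤ q → 0ℚ ≤ q ^ i
^-nonNeg zero 0≤q = nonNegative⁻¹ 1ℚ
^-nonNeg {q} (suc i) 0≤q =
  subst (_≤ q * q ^ i) (*-zeroˡ 0ℚ)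
    (*-mono-≤₀ ≤-refl 0≤q ≤-refl (^-nonNeg i 0≤q))

^-mono-≤ : ∀ i → 0ℚ ≤ p → p ≤ q → p ^ i ≤ q ^ i
^-mono-≤ zero 0≤p p≤q = ≤-refl
^-mono-≤ (suc i) 0≤p p≤q =
  *-mono-≤₀ 0≤p p≤q (^-nonNeg i 0≤p) (^-mono-≤ i 0≤p p≤q)

^-pos : ∀ i → 0ℚ < q → 0ℚ < q ^ i
^-pos zero 0<q = positive⁻¹ 1ℚ
^-pos {q} (suc i) 0<q = subst (_< q * q ^ i) (*-zeroʳ q)
  (*-monoʳ-<-pos q {{positive 0<q}} (^-pos i 0<q))

^-mono-< : ∀ i .{{_ : ℕ.NonZero i}} → 0ℚ ≤ p → p < q → p ^ i < q ^ i
^-mono-< {p} {q} (suc i) 0≤p p<q = ≤-<-trans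
  (*-monoˡ-≤-nonNeg p {{nonNegative 0≤p}} (^-mono-≤ i 0≤p (<⇒≤ p<q)))
  (*-monoˡ-<-pos (q ^ i) {{positive (^-pos i (≤-<-trans 0≤p p<q))}} p<q)

1≤^ : ∀ i → 1ℚ ≤ q → 1ℚ ≤ q ^ i
1≤^ zero 1≤q = ≤-refl
1≤^ (suc i) 1≤q =
  *-mono-≤₀ (nonNegative⁻¹ 1ℚ) 1≤q (nonNegative⁻¹ 1ℚ) (1≤^ i 1≤q)

q≤q^i : ∀ i .{{_ : ℕ.NonZero i}} → 1ℚ ≤ q → q ≤ q ^ i
q≤q^i {q} (suc i) 1≤q = subst (_≤ q * q ^ i) (*-identityʳ q)
  (*-monoˡ-≤-nonNeg q {{nonNegative (≤-trans (nonNegative⁻¹ 1ℚ) 1≤q)}}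
    (1≤^ i 1≤q))

-- n as a rational in a form that allows induction on n
nat : ℕ → ℚ
nat zero    = 0ℚ
nat (suc n) = 1ℚ + nat n

whole : ℕ → ℚ
whole n = mkℚ (ℤ.+ n) 0 (Coprime.sym (1-coprimeTo n))

archimedean : ∀ r → ∃[ n ] r ≤ nat n
archimedean r@(mkℚ m d _) = ℤ.∣ m ∣ , subst (r ≤_) (sym (nat≡whole ℤ.∣ m ∣)) (*≤* (m≤ m))
  where
  open import Data.Rational.Unnormalised.Base as ℚᵘ using (*≡*)
  import Data.Rational.Unnormalised.Properties as ℚᵘ
  nat≡whole : ∀ n → nat n ≡ whole n
  nat≡whole zero = refl
  nat≡whole (suc n) = trans (cong (1ℚ +_) (nat≡whole n))
    (toℚᵘ-injective (ℚᵘ.≃-trans (toℚᵘ-homo-+ 1ℚ (whole n))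
      (*≡* (cong (ℤ._* ℤ.+ 1) (cong (λ k → ℤ.1ℤ ℤ.+ k) (ℤ.*-identityʳ (ℤ.+ n)))))))
  m≤ : ∀ m → m ℤ.* ℤ.+ 1 ℤ.≤ ℤ.+ ℤ.∣ m ∣ ℤ.* ℤ.+ suc d
  m≤ (ℤ.+ n) = ℤ.*-monoˡ-≤-nonNeg (ℤ.+ n) {ℤ.+ 1} {ℤ.+ suc d} (ℤ.+≤+ (s≤s z≤n))
  m≤ -[1+ n ] = ℤ.-≤+

record ℝ : Set₁ where
  field
    L U         : Pred ℚ 0ℓ
    L-inhabited : ∃ L
    U-inhabited : ∃ U
    L-lower     : p < q → L q → L p
    U-upper     : p < q → U p → U q
    L-open      : L p → ∃[ q ] p < q × L q
    U-open      : U q → ∃[ p ] p < q × U p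
    disjoint    : L q → ¬ U q
    located     : p < q → L p ⊎ U q

  L<U : L p → U q → p < q
  L<U {p} {q} Lp Uq with <-cmp p q
  ... | tri< p<q _ _  = p<q
  ... | tri≈ _ refl _ = contradiction Uq (disjoint Lp)
  ... | tri> _ _ q<p  = contradiction Uq (disjoint (L-lower q<p Lp))

open ℝ

infix 4 _≤ℝ_
_≤ℝ_ : ℝ → ℝ → Set
x ≤ℝ y = ∀ {q} → L x q → L y q

fromℚ : ℚ → ℝ
fromℚ p = record
  { L           = _< p
  ; U           = p <_
  ; L-inhabited = p - 1ℚ , q-1<q p
  ; U-inhabited = p + 1ℚ , q<q+1 p
  ; L-lower     = <-trans
  ; U-upper     = λ q<r p<q → <-trans p<q q<r
  ; L-open      = λ q<p → let r , q<r , r<p = <-dense q<p in r , q<r , r<p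
  ; U-open      = λ p<q → let r , p<r , r<q = <-dense p<q in r , r<q , p<r
  ; disjoint    = <-asym
  ; located     = loc
  }
  where
  loc : q < r → q < p ⊎ p < r
  loc {q} q<r with q <? p
  ... | yes q<p = inj₁ q<p
  ... | no  q≮p = inj₂ (≤-<-trans (≮⇒≥ q≮p) q<r)

fromℕ : ℕ → ℝ
fromℕ n = fromℚ (ℤ.+ n / 1)

infixl 6 _⊔ℝ_
_⊔ℝ_ : ℝ → ℝ → ℝ
x ⊔ℝ y = record
  { L           = λ q → L x q ⊎ L y q
  ; U           = λ q → U x q × U y q
  ; L-inhabited = let a , La = L-inhabited x in a , inj₁ La
  ; U-inhabited = uInh
  ; L-lower     = λ { p<q (inj₁ Lq) → inj₁ (L-lower x p<q Lq)
                    ; p<q (inj₂ Lq) → inj₂ (L-lower y p<q Lq) }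
  ; U-upper     = λ p<q (Uxp , Uyp) → U-upper x p<q Uxp , U-upper y p<q Uyp
  ; L-open      = λ { (inj₁ Lp) → let q , p<q , Lq = L-open x Lp in q , p<q , inj₁ Lq
                    ; (inj₂ Lp) → let q , p<q , Lq = L-open y Lp in q , p<q , inj₂ Lq }
  ; U-open      = uOpen
  ; disjoint    = λ { (inj₁ Lq) (Uq , _) → disjoint x Lq Uq
                    ; (inj₂ Lq) (_ , Uq) → disjoint y Lq Uq }
  ; located     = loc
  }
  where
  U-weaken : ∀ z → p ≤ q → U z p → U z q
  U-weaken {p} {q} z p≤q Up with <-cmp p q
  ... | tri< p<q _ _  = U-upper z p<q Up
  ... | tri≈ _ refl _ = Up
  ... | tri> p≮q _ q<p = contradiction (≤-<-trans p≤q q<p) (<-irrefl refl)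
  uInh : ∃[ q ] U x q × U y q
  uInh = let a , Ua = U-inhabited x; b , Ub = U-inhabited y
         in a ⊔ b , U-weaken x (p≤p⊔q a b) Ua , U-weaken y (p≤q⊔p a b) Ub
  uOpen : U x q × U y q → ∃[ p ] p < q × U x p × U y p
  uOpen (Uxq , Uyq) with U-open x Uxq | U-open y Uyq
  ... | a , a<q , Ua | b , b<q , Ub with ≤-total a b
  ...   | inj₁ a≤b = b , b<q , U-weaken x a≤b Ua , Ub
  ...   | inj₂ b≤a = a , a<q , Ua , U-weaken y b≤a Ub
  loc : p < q → (L x p ⊎ L y p) ⊎ (U x q × U y q)
  loc p<q with located x p<q | located y p<q
  ... | inj₁ Lp | _       = inj₁ (inj₁ Lp)
  ... | inj₂ _  | inj₁ Lp = inj₁ (inj₂ Lp)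
  ... | inj₂ Ux | inj₂ Uy = inj₂ (Ux , Uy)

-- root i x is x^{1/i}, as the supremum of { r ≥ 0 : rⁱ < x } and the infimum
-- of { r > 0 : x < rⁱ }.  For x < 0 this gives the value 0.
root : (i : ℕ) .{{_ : ℕ.NonZero i}} → ℝ → ℝ
root i x = record
  { L           = Lʳ
  ; U           = Uʳ
  ; L-inhabited = - 1ℚ , inj₁ (negative⁻¹ (- 1ℚ))
  ; U-inhabited = uInh
  ; L-lower     = lower
  ; U-upper     = λ { p<q (r , 0<r , r<p , Ur) → r , 0<r , <-trans r<p p<q , Ur }
  ; L-open      = lOpen
  ; U-open      = λ { (r , 0<r , r<q , Ur) →
                      let m , r<m , m<q = <-dense r<q
                      in m , m<q , r , 0<r , r<m , Ur }
  ; disjoint    = disj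
  ; located     = loc
  }
  where
  Lʳ Uʳ : Pred ℚ 0ℓ
  Lʳ q = q < 0ℚ ⊎ ∃[ r ] q < r × L x (r ^ i)
  Uʳ q = ∃[ r ] 0ℚ < r × r < q × U x (r ^ i)
  uInh : ∃ Uʳ
  uInh with U-inhabited x
  ... | b , Ub = m + 1ℚ , m , 0<m , q<q+1 m , Um
    where
    m = (b ⊔ 1ℚ) + 1ℚ
    1≤m : 1ℚ ≤ m
    1≤m = ≤-trans (p≤q⊔p b 1ℚ) (<⇒≤ (q<q+1 (b ⊔ 1ℚ)))
    0<m : 0ℚ < m
    0<m = <-≤-trans (positive⁻¹ 1ℚ) 1≤m
    Um : U x (m ^ i)
    Um = U-upper x
      (<-≤-trans (≤-<-trans (p≤p⊔q b 1ℚ) (q<q+1 (b ⊔ 1ℚ))) (q≤q^i i 1≤m)) Ub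
  lower : p < q → Lʳ q → Lʳ p
  lower p<q (inj₁ q<0)            = inj₁ (<-trans p<q q<0)
  lower p<q (inj₂ (r , q<r , Lr)) = inj₂ (r , <-trans p<q q<r , Lr)
  lOpen : Lʳ p → ∃[ q ] p < q × Lʳ q
  lOpen (inj₁ p<0) = let m , p<m , m<0 = <-dense p<0 in m , p<m , inj₁ m<0
  lOpen (inj₂ (r , p<r , Lr)) =
    let m , p<m , m<r = <-dense p<r in m , p<m , inj₂ (r , m<r , Lr)
  disj : Lʳ q → ¬ Uʳ q
  disj (inj₁ q<0) (r , 0<r , r<q , _) = <-asym q<0 (<-trans 0<r r<q)
  disj (inj₂ (s , q<s , Ls)) (r , 0<r , r<q , Ur) = <-irrefl refl
    (<-≤-trans (L<U x Ls Ur) (^-mono-≤ i (<⇒≤ 0<r) (<⇒≤ (<-trans r<q q<s))))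
  loc : p < q → Lʳ p ⊎ Uʳ q
  loc {p} {q} p<q with p <? 0ℚ
  ... | yes p<0 = inj₁ (inj₁ p<0)
  ... | no  p≮0 with <-dense p<q
  ...   | n , p<n , n<q with <-dense p<n
  ...     | m , p<m , m<n
            with located x (^-mono-< i (≤-trans (≮⇒≥ p≮0) (<⇒≤ p<m)) m<n)
  ...       | inj₁ Lm = inj₁ (inj₂ (m , p<m , Lm))
  ...       | inj₂ Un = inj₂ (n , ≤-<-trans (≮⇒≥ p≮0) p<n , n<q , Un)

-- The product of reals is defined by interval arithmetic: the extreme values
-- of u * v for a ≤ u ≤ b and c ≤ v ≤ d are attained at corners.
minProd maxProd : (a b c d : ℚ) → ℚ
minProd a b c d = ((a * c) ⊓ (a * d)) ⊓ ((b * c) ⊓ (b * d))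
maxProd a b c d = ((a * c) ⊔ (a * d)) ⊔ ((b * c) ⊔ (b * d))

module _ {a b c d u v : ℚ} (a≤u : a ≤ u) (u≤b : u ≤ b) (c≤v : c ≤ v) (v≤d : v ≤ d) where
  *-between : ∀ z → u * z ≤ (a * z) ⊔ (b * z) × (a * z) ⊓ (b * z) ≤ u * z
  *-between z with ≤-total 0ℚ z
  ... | inj₁ 0≤z =
    ≤-trans (*-monoʳ-≤-nonNeg z {{nonNegative 0≤z}} u≤b) (p≤q⊔p (a * z) (b * z)) ,
    ≤-trans (p⊓q≤p (a * z) (b * z)) (*-monoʳ-≤-nonNeg z {{nonNegative 0≤z}} a≤u)
  ... | inj₂ z≤0 =
    ≤-trans (*-monoʳ-≤-nonPos z {{nonPositive z≤0}} a≤u) (p≤p⊔q (a * z) (b * z)) ,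
    ≤-trans (p⊓q≤q (a * z) (b * z)) (*-monoʳ-≤-nonPos z {{nonPositive z≤0}} u≤b)

  *-betweenʳ : ∀ z → z * v ≤ (z * c) ⊔ (z * d) × (z * c) ⊓ (z * d) ≤ z * v
  *-betweenʳ z with ≤-total 0ℚ z
  ... | inj₁ 0≤z =
    ≤-trans (*-monoˡ-≤-nonNeg z {{nonNegative 0≤z}} v≤d) (p≤q⊔p (z * c) (z * d)) ,
    ≤-trans (p⊓q≤p (z * c) (z * d)) (*-monoˡ-≤-nonNeg z {{nonNegative 0≤z}} c≤v)
  ... | inj₂ z≤0 =
    ≤-trans (*-monoˡ-≤-nonPos z {{nonPositive z≤0}} c≤v) (p≤p⊔q (z * c) (z * d)) ,
    ≤-trans (p⊓q≤q (z * c) (z * d)) (*-monoˡ-≤-nonPos z {{nonPositive z≤0}} v≤d)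

  minProd-≤ : minProd a b c d ≤ u * v
  minProd-≤ = ≤-trans (⊓-mono-≤ (proj₂ (*-betweenʳ a)) (proj₂ (*-betweenʳ b)))
                      (proj₂ (*-between v))

  ≤-maxProd : u * v ≤ maxProd a b c d
  ≤-maxProd = ≤-trans (proj₁ (*-between v))
                      (⊔-mono-≤ (proj₁ (*-betweenʳ a)) (proj₁ (*-betweenʳ b)))

open +-*-Solver using (solve; _:=_; _:+_; _:*_; _:-_; :-_; con)

a+b-a : ∀ a b → a + (b - a) ≡ b
a+b-a = solve 2 (λ a b → a :+ (b :- a) := b) refl

≤⇒0≤- : p ≤ q → 0ℚ ≤ q - p
≤⇒0≤- {p} {q} p≤q = subst (_≤ q - p) (+-inverseʳ p) (+-monoˡ-≤ (- p) p≤q)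

≤+⇒-≤ : ∀ p q r → q ≤ p + r → q - p ≤ r
≤+⇒-≤ p q r q≤ = subst (q - p ≤_)
  (solve 2 (λ p r → (p :+ r) :- p := r) refl p r) (+-monoˡ-≤ (- p) q≤)

module Approx (x : ℝ) {a₀ b₀ δ : ℚ} (La₀ : L x a₀) (Ub₀ : U x b₀) (0<δ : 0ℚ < δ) where

  walk : ∀ n a → a₀ ≤ a → L x a → U x (a + (nat n * δ + (δ + δ))) →
         ∃[ a′ ] a₀ ≤ a′ × L x a′ × U x (a′ + (δ + δ))
  walk zero a a₀≤a La Ub = a , a₀≤a , La , subst (U x)
    (solve 2 (λ a δ → a :+ (con 0ℚ :* δ :+ (δ :+ δ)) := a :+ (δ :+ δ)) refl a δ) Ub
  walk (suc n) a a₀≤a La Ub with located x a+δ<a+2δ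
    where
    a+δ<a+2δ : a + δ < a + (δ + δ)
    a+δ<a+2δ = +-monoʳ-< a (subst (_< δ + δ) (+-identityʳ δ) (+-monoʳ-< δ 0<δ))
  ... | inj₁ La+δ = walk n (a + δ) (≤-trans a₀≤a a≤a+δ) La+δ (subst (U x)
    (solve 3 (λ a n δ → a :+ ((con 1ℚ :+ n) :* δ :+ (δ :+ δ))
                        := (a :+ δ) :+ (n :* δ :+ (δ :+ δ))) refl a (nat n) δ) Ub)
    where
    a≤a+δ : a ≤ a + δ
    a≤a+δ = subst (_≤ a + δ) (+-identityʳ a) (+-monoʳ-≤ a (<⇒≤ 0<δ))
  ... | inj₂ Ua+2δ = a , a₀≤a , La , Ua+2δ

  private instance
    _ = positive 0<δ
    _ = pos⇒nonZero δ

  b₀<end : ∀ n → (b₀ - a₀) * 1/ δ ≤ nat n → b₀ < a₀ + (nat n * δ + (δ + δ))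
  b₀<end n le = subst (_< a₀ + (nat n * δ + (δ + δ)))
    (trans (cong (a₀ +_) (+-identityʳ (b₀ - a₀))) (a+b-a a₀ b₀))
    (+-monoʳ-< a₀ (+-mono-≤-< b₀-a₀≤ (positive⁻¹ (δ + δ) {{pos+pos⇒pos δ δ}})))
    where
    b₀-a₀≤ : b₀ - a₀ ≤ nat n * δ
    b₀-a₀≤ = subst (_≤ nat n * δ)
      (trans (*-assoc (b₀ - a₀) (1/ δ) δ)
        (trans (cong ((b₀ - a₀) *_) (*-inverseˡ δ)) (*-identityʳ (b₀ - a₀))))
      (*-monoʳ-≤-nonNeg δ {{pos⇒nonNeg δ}} le)

  U-⊓ : U x p → U x q → U x (p ⊓ q)
  U-⊓ {p} {q} Up Uq with ⊓-sel p q
  ... | inj₁ eq = subst (U x) (sym eq) Up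
  ... | inj₂ eq = subst (U x) (sym eq) Uq

  approx : ∃[ a ] ∃[ b ] L x a × U x b × a₀ ≤ a × b ≤ b₀ × b - a ≤ δ + δ
  approx =
    let n , le = archimedean ((b₀ - a₀) * 1/ δ)
        a , a₀≤a , La , Ub = walk n a₀ ≤-refl La₀ (U-upper x (b₀<end n le) Ub₀)
        b = a + (δ + δ)
    in a , b ⊓ b₀ , La , U-⊓ Ub Ub₀ , a₀≤a , p⊓q≤q b b₀ ,
       ≤+⇒-≤ a (b ⊓ b₀) (δ + δ) (p⊓q≤p b b₀)

-- ∣ r ∣ ≤ s
Within : ℚ → ℚ → Set
Within s r = - s ≤ r × r ≤ s

within-0 : 0ℚ ≤ s → Within s 0ℚ
within-0 0≤s = neg-antimono-≤ 0≤s , 0≤s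

within-+ : ∀ {f g u v} → Within f u → Within g v → Within (f + g) (u + v)
within-+ {f} {g} {u} {v} (l , h) (l′ , h′) =
  subst (_≤ u + v) (sym (neg-distrib-+ f g)) (+-mono-≤ l l′) , +-mono-≤ h h′

within-* : ∀ {K c} s → 0ℚ ≤ s → Within K c → Within (s * K) (s * c)
within-* {K} {c} s 0≤s (l , h) =
  subst (_≤ s * c) (sym (neg-distribʳ-* s K)) (*-monoˡ-≤-nonNeg s l) ,
  *-monoˡ-≤-nonNeg s h
  where instance _ = nonNegative 0≤s

module Spread {K a b c d : ℚ} (a≤b : a ≤ b) (c≤d : c ≤ d)
              (wa : Within K a) (wb : Within K b) (wc : Within K c) where
  f g e : ℚ
  f = (b - a) * K
  g = (d - c) * K
  e = f + g

  0≤K : 0ℚ ≤ K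
  0≤K with ≤-total 0ℚ K
  ... | inj₁ 0≤K = 0≤K
  ... | inj₂ K≤0 = ≤-trans (neg-antimono-≤ K≤0) (≤-trans (proj₁ wa) (proj₂ wa))

  0≤f : 0ℚ ≤ f
  0≤f = subst (_≤ f) (*-zeroˡ 0ℚ) (*-mono-≤₀ ≤-refl (≤⇒0≤- a≤b) ≤-refl 0≤K)
  0≤g : 0ℚ ≤ g
  0≤g = subst (_≤ g) (*-zeroˡ 0ℚ) (*-mono-≤₀ ≤-refl (≤⇒0≤- c≤d) ≤-refl 0≤K)

  near : ∀ {u v w} → Within f u → Within g v → a * c + (u + v) ≡ w →
         a * c - e ≤ w × w ≤ a * c + e
  near {w = w} wu wv eq =
    subst (a * c - e ≤_) eq (+-monoʳ-≤ (a * c) (proj₁ (within-+ wu wv))) ,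
    subst (_≤ a * c + e) eq (+-monoʳ-≤ (a * c) (proj₂ (within-+ wu wv)))

  nac = near (within-0 0≤f) (within-0 0≤g) (+-identityʳ (a * c))
  nad = near (within-0 0≤f) (within-* (d - c) (≤⇒0≤- c≤d) wa)
    (solve 3 (λ a c d → a :* c :+ (con 0ℚ :+ (d :- c) :* a) := a :* d) refl a c d)
  nbc = near (within-* (b - a) (≤⇒0≤- a≤b) wc) (within-0 0≤g)
    (solve 3 (λ a b c → a :* c :+ ((b :- a) :* c :+ con 0ℚ) := b :* c) refl a b c)
  nbd = near (within-* (b - a) (≤⇒0≤- a≤b) wc) (within-* (d - c) (≤⇒0≤- c≤d) wb)
    (solve 4 (λ a b c d → a :* c :+ ((b :- a) :* c :+ (d :- c) :* b) := b :* d)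
      refl a b c d)

  spread : maxProd a b c d ≤ minProd a b c d + (e + e)
  spread = ≤-trans
    (⊔-lub (⊔-lub (proj₂ nac) (proj₂ nad)) (⊔-lub (proj₂ nbc) (proj₂ nbd)))
    (subst (_≤ minProd a b c d + (e + e))
      (solve 2 (λ m e → (m :- e) :+ (e :+ e) := m :+ e) refl (a * c) e)
      (+-monoˡ-≤ (e + e)
        (⊓-glb (⊓-glb (proj₁ nac) (proj₁ nad)) (⊓-glb (proj₁ nbc) (proj₁ nbd)))))

infixl 7 _*ℝ_
_*ℝ_ : ℝ → ℝ → ℝ
x *ℝ y = record
  { L           = L*
  ; U           = U*
  ; L-inhabited =
      let a , La = L-inhabited x; b , Ub = U-inhabited x
          c , Lc = L-inhabited y; d , Ud = U-inhabited y
      in minProd a b c d - 1ℚ , a , b , c , d , La , Ub , Lc , Ud , q-1<q _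
  ; U-inhabited =
      let a , La = L-inhabited x; b , Ub = U-inhabited x
          c , Lc = L-inhabited y; d , Ud = U-inhabited y
      in maxProd a b c d + 1ℚ , a , b , c , d , La , Ub , Lc , Ud , q<q+1 _
  ; L-lower     = λ { p<q (a , b , c , d , La , Ub , Lc , Ud , q<) →
                      a , b , c , d , La , Ub , Lc , Ud , <-trans p<q q< }
  ; U-upper     = λ { p<q (a , b , c , d , La , Ub , Lc , Ud , <p) →
                      a , b , c , d , La , Ub , Lc , Ud , <-trans <p p<q }
  ; L-open      = λ { (a , b , c , d , La , Ub , Lc , Ud , p<) →
                      let m , p<m , m< = <-dense p<
                      in m , p<m , a , b , c , d , La , Ub , Lc , Ud , m< }
  ; U-open      = λ { (a , b , c , d , La , Ub , Lc , Ud , <q) →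
                      let m , <m , m<q = <-dense <q
                      in m , m<q , a , b , c , d , La , Ub , Lc , Ud , <m }
  ; disjoint    = disj
  ; located     = loc
  }
  where
  L* U* : Pred ℚ 0ℓ
  L* q = ∃[ a ] ∃[ b ] ∃[ c ] ∃[ d ]
         L x a × U x b × L y c × U y d × q < minProd a b c d
  U* q = ∃[ a ] ∃[ b ] ∃[ c ] ∃[ d ]
         L x a × U x b × L y c × U y d × maxProd a b c d < q

  common : ∀ (z : ℝ) {a b a′ b′} → L z a → U z b → L z a′ → U z b′ →
           ∃[ u ] a ≤ u × u ≤ b × a′ ≤ u × u ≤ b′
  common z {a} {b} {a′} {b′} La Ub La′ Ub′ =
    a ⊔ a′ , p≤p⊔q a a′ , ⊔-lub (<⇒≤ (L<U z La Ub)) (<⇒≤ (L<U z La′ Ub)) ,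
    p≤q⊔p a a′ , ⊔-lub (<⇒≤ (L<U z La Ub′)) (<⇒≤ (L<U z La′ Ub′))

  disj : L* q → ¬ U* q
  disj (a , b , c , d , La , Ub , Lc , Ud , q<)
       (a′ , b′ , c′ , d′ , La′ , Ub′ , Lc′ , Ud′ , <q)
    with common x La Ub La′ Ub′ | common y Lc Ud Lc′ Ud′
  ... | u , a≤u , u≤b , a′≤u , u≤b′ | v , c≤v , v≤d , c′≤v , v≤d′ =
    <-irrefl refl (<-trans (<-≤-trans q< (minProd-≤ a≤u u≤b c≤v v≤d))
                           (≤-<-trans (≤-maxProd a′≤u u≤b′ c′≤v v≤d′) <q))

  loc : p < q → L* p ⊎ U* q
  loc {p} {q} p<q = go (Approx.approx x La₀ Ub₀ 0<δ) (Approx.approx y Lc₀ Ud₀ 0<δ)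
    where
    a₀ = proj₁ (L-inhabited x)
    b₀ = proj₁ (U-inhabited x)
    c₀ = proj₁ (L-inhabited y)
    d₀ = proj₁ (U-inhabited y)
    La₀ = proj₂ (L-inhabited x)
    Ub₀ = proj₂ (U-inhabited x)
    Lc₀ = proj₂ (L-inhabited y)
    Ud₀ = proj₂ (U-inhabited y)

    K ε δ : ℚ
    K = 1ℚ ⊔ ((b₀ ⊔ d₀) ⊔ (- a₀ ⊔ - c₀))
    1≤K : 1ℚ ≤ K
    1≤K = p≤p⊔q 1ℚ ((b₀ ⊔ d₀) ⊔ (- a₀ ⊔ - c₀))
    rest≤K : (b₀ ⊔ d₀) ⊔ (- a₀ ⊔ - c₀) ≤ K
    rest≤K = p≤q⊔p 1ℚ ((b₀ ⊔ d₀) ⊔ (- a₀ ⊔ - c₀))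
    b₀≤K : b₀ ≤ K
    b₀≤K = ≤-trans (≤-trans (p≤p⊔q b₀ d₀) (p≤p⊔q (b₀ ⊔ d₀) (- a₀ ⊔ - c₀))) rest≤K
    d₀≤K : d₀ ≤ K
    d₀≤K = ≤-trans (≤-trans (p≤q⊔p b₀ d₀) (p≤p⊔q (b₀ ⊔ d₀) (- a₀ ⊔ - c₀))) rest≤K
    neg≤K : ∀ z → - z ≤ K → - K ≤ z
    neg≤K z h = subst (- K ≤_) (solve 1 (λ z → :- (:- z) := z) refl z) (neg-antimono-≤ h)
    -K≤a₀ : - K ≤ a₀
    -K≤a₀ = neg≤K a₀
      (≤-trans (≤-trans (p≤p⊔q (- a₀) (- c₀)) (p≤q⊔p (b₀ ⊔ d₀) (- a₀ ⊔ - c₀))) rest≤K)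
    -K≤c₀ : - K ≤ c₀
    -K≤c₀ = neg≤K c₀
      (≤-trans (≤-trans (p≤q⊔p (- a₀) (- c₀)) (p≤q⊔p (b₀ ⊔ d₀) (- a₀ ⊔ - c₀))) rest≤K)

    0<K : 0ℚ < K
    0<K = <-≤-trans (positive⁻¹ 1ℚ) 1≤K
    ε = q - p
    0<ε : 0ℚ < ε
    0<ε = subst (_< ε) (+-inverseʳ p) (+-monoˡ-< (- p) p<q)
    instance
      _ = positive 0<K
      _ = pos⇒nonZero K
      _ = positive 0<ε
    1/16 1/2 : ℚ
    1/16 = ℤ.+ 1 / 16
    1/2 = ℤ.+ 1 / 2
    δ = (ε * 1/16) * 1/ K
    0<δ : 0ℚ < δ
    0<δ = positive⁻¹ δ {{pos*pos⇒pos (ε * 1/16) {{pos*pos⇒pos ε 1/16}} (1/ K) {{1/pos⇒pos K}}}}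

    η : ℚ
    η = (δ + δ) * K
    8δK : (η + η) + (η + η) ≡ ε * 1/2
    8δK = trans
      (solve 3 (λ ε k K →
        let δ = (ε :* con 1/16) :* k; η = (δ :+ δ) :* K
        in (η :+ η) :+ (η :+ η) := (ε :* con 1/2) :* (k :* K)) refl ε (1/ K) K)
      (trans (cong (ε * 1/2 *_) (*-inverseˡ K)) (*-identityʳ (ε * 1/2)))
    ε/2<ε : ε * 1/2 < ε
    ε/2<ε = subst (ε * 1/2 <_) (*-identityʳ ε)
      (*-monoʳ-<-pos ε {1/2} {1ℚ} (*<* (ℤ.+<+ (s≤s (s≤s z≤n)))))

    go : (∃[ a ] ∃[ b ] L x a × U x b × a₀ ≤ a × b ≤ b₀ × b - a ≤ δ + δ) →
         (∃[ c ] ∃[ d ] L y c × U y d × c₀ ≤ c × d ≤ d₀ × d - c ≤ δ + δ) →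
         L* p ⊎ U* q
    go (a , b , La , Ub , a₀≤a , b≤b₀ , s≤) (c , d , Lc , Ud , c₀≤c , d≤d₀ , t≤)
      with p <? minProd a b c d
    ... | yes p< = inj₁ (a , b , c , d , La , Ub , Lc , Ud , p<)
    ... | no  p≮ = inj₂ (a , b , c , d , La , Ub , Lc , Ud , <q)
      where
      a≤b = <⇒≤ (L<U x La Ub)
      c≤d = <⇒≤ (L<U y Lc Ud)
      module S = Spread {K} {a} {b} {c} {d} a≤b c≤d
        (≤-trans -K≤a₀ a₀≤a , ≤-trans a≤b (≤-trans b≤b₀ b₀≤K))
        (≤-trans (≤-trans -K≤a₀ a₀≤a) a≤b , ≤-trans b≤b₀ b₀≤K)
        (≤-trans -K≤c₀ c₀≤c , ≤-trans c≤d (≤-trans d≤d₀ d₀≤K))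
      e≤ : S.e ≤ η + η
      e≤ = +-mono-≤ (*-monoʳ-≤-nonNeg K {{pos⇒nonNeg K}} s≤)
                    (*-monoʳ-≤-nonNeg K {{pos⇒nonNeg K}} t≤)
      2e<ε : S.e + S.e < ε
      2e<ε = ≤-<-trans (≤-trans (+-mono-≤ e≤ e≤) (≤-reflexive 8δK)) ε/2<ε
      <q : maxProd a b c d < q
      <q = subst (maxProd a b c d <_) (a+b-a p q)
        (≤-<-trans S.spread (+-mono-≤-< (≮⇒≥ p≮) 2e<ε))

-- Natural numbers start at 1 here: 𝒮, ℬ, 𝒟 and 𝒟* contain no zero.

𝒮 : ℝ → Pred ℕ 0ℓ
𝒮 y n = ℕ.NonZero n × (∀ {p} → Prime p → p ∣ n → fromℕ p ≤ℝ y)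

-- The empty list of primes accounts for the element 1.
ℬ : (ℕ → ℝ) → Pred ℕ 0ℓ
ℬ θ n = Σ[ ps ∈ List ℕ ]
  All Prime ps × Sorted ps × n ≡ product ps ×
  (∀ (j : Fin (length ps)) → fromℕ (lookup ps j) ≤ℝ θ (product (take (toℕ j) ps)))

Consecutive : Pred ℕ 0ℓ → ℕ → ℕ → Set
Consecutive A a b = A a × A b × a ℕ.< b × (∀ {c} → A c → a ℕ.< c → ¬ c ℕ.< b)

Dense : ℝ → Pred ℕ 0ℓ → Set
Dense y A = ∀ {a b} .{{_ : ℕ.NonZero a}} → Consecutive A a b → fromℚ (ℤ.+ b / a) ≤ℝ y

DenseFrom1To : ℕ → ℝ → Pred ℕ 0ℓ → Set
DenseFrom1To n y A = Dense y A × A 1 × A n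

𝒟 : ℕ → ℝ → Pred ℕ 0ℓ
𝒟 zero    y n = ℕ.NonZero n
𝒟 (suc i) y n = DenseFrom1To n y (λ d → d ∣ n × 𝒟 i y d)

-- 𝒟* (suc i) refers to all 𝒟* j with j ≤ i, hence the recursion on
-- accessibility; 𝒟*-suc below is the defining equivalence.
𝒟*-acc : ∀ i → Acc ℕ._<_ i → ℝ → Pred ℕ 0ℓ
𝒟*-acc zero    _        y n = ℕ.NonZero n
𝒟*-acc (suc i) (acc rs) y n = ∀ j (j≤i : j ℕ.≤ i) → DenseFrom1To n y λ d →
  Σ[ d∣n ∈ d ∣ n ]
    𝒟*-acc j (rs (s≤s j≤i)) y d ×
    𝒟*-acc (i ℕ.∸ j) (rs (s≤s (ℕ.m∸n≤m i j))) y (quotient d∣n)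

𝒟* : ℕ → ℝ → Pred ℕ 0ℓ
𝒟* i = 𝒟*-acc i (<-wellFounded i)

DenseFrom1To-resp : ∀ n y {A B : Pred ℕ 0ℓ} → (∀ d → A d ⇔ B d) →
                    DenseFrom1To n y A → DenseFrom1To n y B
DenseFrom1To-resp n y A⇔B (dense , A1 , An) =
  (λ (Ba , Bb , a<b , none) → dense (from Ba , from Bb , a<b , none ∘ to)) , to A1 , to An
  where open module A⇔B {d} = Equivalence (A⇔B d) using (to; from)

𝒟*-acc-irr : ∀ i (α β : Acc ℕ._<_ i) {y n} → 𝒟*-acc i α y n → 𝒟*-acc i β y n
×-𝒟*-acc-irr : ∀ i j (α β : Acc ℕ._<_ i) (γ δ : Acc ℕ._<_ j) {y n} d →
  (Σ[ d∣n ∈ d ∣ n ] 𝒟*-acc i α y d × 𝒟*-acc j γ y (quotient d∣n)) ⇔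
  (Σ[ d∣n ∈ d ∣ n ] 𝒟*-acc i β y d × 𝒟*-acc j δ y (quotient d∣n))

𝒟*-acc-irr zero    _        _        n≢0 = n≢0
𝒟*-acc-irr (suc i) (acc rs) (acc ss) {y} {n} h j j≤i =
  DenseFrom1To-resp n y (×-𝒟*-acc-irr j (i ℕ.∸ j) _ _ _ _) (h j j≤i)

×-𝒟*-acc-irr i j α β γ δ d = mk⇔
  (λ (d∣n , hd , he) → d∣n , 𝒟*-acc-irr i α β hd , 𝒟*-acc-irr j γ δ he)
  (λ (d∣n , hd , he) → d∣n , 𝒟*-acc-irr i β α hd , 𝒟*-acc-irr j δ γ he)

𝒟*-suc : ∀ i {y n} → 𝒟* (suc i) y n ⇔
  (∀ j → j ℕ.≤ i → DenseFrom1To n y λ d →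
    Σ[ d∣n ∈ d ∣ n ] 𝒟* j y d × 𝒟* (i ℕ.∸ j) y (quotient d∣n))
𝒟*-suc i {y} {n} = mk⇔
  (λ h j j≤i → DenseFrom1To-resp n y (×-𝒟*-acc-irr j (i ℕ.∸ j) _ _ _ _) (h j j≤i))
  (λ h j j≤i → DenseFrom1To-resp n y (×-𝒟*-acc-irr j (i ℕ.∸ j) _ _ _ _) (h j j≤i))

θₗ θᵤ : (i : ℕ) .{{_ : ℕ.NonZero i}} → ℝ → ℕ → ℝ
θₗ i y n = y ⊔ℝ root i (y *ℝ fromℕ n)
θᵤ i y n = y *ℝ root i (fromℕ n)

{-# OPTIONS --safe #-}

-- Both 𝒟 and 𝒟* are stable under double negation, because x ≤ℝ y fails only if some rational
-- lies strictly between y and x; the argument can therefore be classical.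
--
-- 𝒟 ⊆ ℬ θᵤ.  By induction on i, if u * v ∈ 𝒟 i and v > 1 has no prime factor below p, then
-- pⁱ ≤ yⁱ u.  For i + 1, let b be the least divisor of u * v in 𝒟 i that does not divide u.
-- It is at most y times an element that does divide u, so b ≤ y u; writing b = u′ v′ with
-- u′ ∣ u and v′ ∣ v, the induction hypothesis gives pⁱ ≤ yⁱ u′, and p ≤ v′.
--
-- ℬ θₗ ⊆ 𝒟*.  With i = 1 + j + c, one shows by induction on the number of factors that the d
-- with n = e d, d ∈ ℬ θₗ (for j) and e ∈ ℬ θₗ (for c) are y-dense.  Passing from n to n p, each
-- such d can be kept if e may be multiplied by p, and replaced by d p if d may be.

module Submission where

-- Inequalities between naturals, rationals and Dedekind reals

module Comparison where

  open import Defs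
  open import Algebra.Bundles using (CommutativeRing)
  open import Data.Empty using (⊥)
  import Data.Integer.Base as ℤ
  import Data.Integer.Properties as ℤ
  open import Data.Nat.Base as ℕ using (ℕ; zero; suc; z≤n; s≤s)
  import Data.Nat.Properties as ℕ
  open import Data.Product.Base using (∃-syntax; _×_; _,_)
  open import Data.Rational.Base using (ℚ; 0ℚ; 1ℚ; _≤_; _<_; _*_; _⊓_; _⊔_; _/_; 1/_; toℚᵘ;
    *≤*; *<*; positive; nonNegative)
  open import Data.Rational.Properties
  import Data.Rational.Unnormalised.Base as ℚᵘ
  import Data.Rational.Unnormalised.Properties as ℚᵘ
  open import Data.Sum.Base using (_⊎_; inj₁; inj₂)
  open import Relation.Binary.PropositionalEquality
  open import Relation.Nullary using (¬_; yes; no; contradiction)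
  open import Relation.Nullary.Decidable using (decidable-stable)

  open import Algebra.Properties.CommutativeSemiring.Exp
    (CommutativeRing.commutativeSemiring +-*-commutativeRing) using (^-distrib-*)

  open ℝ

  ι : ℕ → ℚ
  ι n = ℤ.+ n / 1

  ι≡whole : ∀ n → ι n ≡ whole n
  ι≡whole n = ↥p/↧p≡p (whole n)

  ι-mono : ∀ {m n} → m ℕ.≤ n → ι m ≤ ι n
  ι-mono {m} {n} m≤n = subst₂ _≤_ (sym (ι≡whole m)) (sym (ι≡whole n))
    (*≤* (ℤ.*-monoʳ-≤-nonNeg (ℤ.+ 1) (ℤ.+≤+ m≤n)))

  0≤ι : ∀ n → 0ℚ ≤ ι n
  0≤ι n = ι-mono {0} {n} z≤n

  ι>0 : ∀ n .{{_ : ℕ.NonZero n}} → 0ℚ < ι n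
  ι>0 n = <-≤-trans (positive⁻¹ 1ℚ) (ι-mono {1} {n} (ℕ.>-nonZero⁻¹ n))

  toℚᵘ-ι : ∀ n → toℚᵘ (ι n) ℚᵘ.≃ ℚᵘ.mkℚᵘ (ℤ.+ n) 0
  toℚᵘ-ι n = toℚᵘ-fromℚᵘ (ℚᵘ.mkℚᵘ (ℤ.+ n) 0)

  ι-* : ∀ m n → ι (m ℕ.* n) ≡ ι m * ι n
  ι-* m n = toℚᵘ-injective (begin
    toℚᵘ (ι (m ℕ.* n))                             ≈⟨ toℚᵘ-ι (m ℕ.* n) ⟩
    ℚᵘ.mkℚᵘ (ℤ.+ (m ℕ.* n)) 0                      ≈⟨ ℚᵘ.*≡* (cong (ℤ._* ℤ.1ℤ) (ℤ.pos-* m n)) ⟩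
    ℚᵘ.mkℚᵘ (ℤ.+ m) 0 ℚᵘ.* ℚᵘ.mkℚᵘ (ℤ.+ n) 0       ≈⟨ ℚᵘ.*-cong (toℚᵘ-ι m) (toℚᵘ-ι n) ⟨
    toℚᵘ (ι m) ℚᵘ.* toℚᵘ (ι n)                     ≈⟨ toℚᵘ-homo-* (ι m) (ι n) ⟨
    toℚᵘ (ι m * ι n)                               ∎)
    where open import Relation.Binary.Reasoning.Setoid ℚᵘ.≃-setoid

  ι-^ : ∀ p i → ι (p ℕ.^ i) ≡ ι p ^ i
  ι-^ p zero    = refl
  ι-^ p (suc i) = trans (ι-* p (p ℕ.^ i)) (cong (ι p *_) (ι-^ p i))

  /-*-ι : ∀ b a .{{_ : ℕ.NonZero a}} → (ℤ.+ b / a) * ι a ≡ ι b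
  /-*-ι b a@(suc a-1) = toℚᵘ-injective (begin
    toℚᵘ ((ℤ.+ b / a) * ι a)                       ≈⟨ toℚᵘ-homo-* (ℤ.+ b / a) (ι a) ⟩
    toℚᵘ (ℤ.+ b / a) ℚᵘ.* toℚᵘ (ι a)               ≈⟨ ℚᵘ.*-cong (toℚᵘ-fromℚᵘ (ℚᵘ.mkℚᵘ (ℤ.+ b) a-1))
                                                             (toℚᵘ-ι a) ⟩
    ℚᵘ.mkℚᵘ (ℤ.+ b) a-1 ℚᵘ.* ℚᵘ.mkℚᵘ (ℤ.+ a) 0     ≈⟨ ℚᵘ.*≡* (trans (ℤ.*-identityʳ _)
                                                        (cong (λ k → ℤ.+ b ℤ.* ℤ.+ k) (sym (ℕ.*-identityʳ a)))) ⟩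
    ℚᵘ.mkℚᵘ (ℤ.+ b) 0                              ≈⟨ toℚᵘ-ι b ⟨
    toℚᵘ (ι b)                                     ∎)
    where open import Relation.Binary.Reasoning.Setoid ℚᵘ.≃-setoid

  below-* : ∀ {s p t} → 0ℚ < t → 0ℚ ≤ s → s < p * t → ∃[ r ] 0ℚ < r × r < p × s < r * t
  below-* {s} {p} {t} 0<t 0≤s s<pt =
    let r , s/t<r , r<p = <-dense s/t<p
        s<rt = subst (_< r * t) (s/t*t≡s) (*-monoˡ-<-pos t s/t<r)
    in r , *-cancelʳ-<-nonNeg t (subst (_< r * t) (sym (*-zeroˡ t)) (≤-<-trans 0≤s s<rt)) , r<p , s<rt
    where
    instance
      _ = positive 0<t
      _ = pos⇒nonZero t
      _ = pos⇒nonNeg t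
    s/t*t≡s : s * 1/ t * t ≡ s
    s/t*t≡s = trans (*-assoc s (1/ t) t) (trans (cong (s *_) (*-inverseˡ t)) (*-identityʳ s))
    s/t<p : s * 1/ t < p
    s/t<p = *-cancelʳ-<-nonNeg t (subst (_< p * t) (sym s/t*t≡s) s<pt)

  ⊔-lub-< : ∀ {p r q} → r < p → q < p → r ⊔ q < p
  ⊔-lub-< {p} {r} {q} r<p q<p with ⊔-sel r q
  ... | inj₁ eq = subst (_< p) (sym eq) r<p
  ... | inj₂ eq = subst (_< p) (sym eq) q<p

  -- The lower cut of root i x only bounds qⁱ for q < p; this passes to the limit pⁱ.
  below-^ : ∀ i {s p} → 0ℚ < p → 0ℚ ≤ s → s < p ^ i → ∃[ q ] 0ℚ < q × q < p × s < q ^ i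
  below-^ zero    0<p 0≤s s<1 = let q , 0<q , q<p = <-dense 0<p in q , 0<q , q<p , s<1
  below-^ (suc i) {s} {p} 0<p 0≤s s<p^ =
    let r , 0<r , r<p , s<rt = below-* (^-pos i 0<p) 0≤s s<p^
        u , 0<u , u<p^ , s<ur = below-* 0<r 0≤s (subst (s <_) (*-comm r (p ^ i)) s<rt)
        q , 0<q , q<p , u<q^ = below-^ i 0<p (<⇒≤ 0<u) u<p^
        q≤r⊔q = p≤q⊔p r q
        u≤^ = ≤-trans (<⇒≤ u<q^) (^-mono-≤ i (<⇒≤ 0<q) q≤r⊔q)
    in r ⊔ q , <-≤-trans 0<q q≤r⊔q , ⊔-lub-< r<p q<p ,
       <-≤-trans (subst (s <_) (*-comm u r) s<ur)
         (*-mono-≤₀ (<⇒≤ 0<r) (p≤p⊔q r q) (<⇒≤ 0<u) u≤^)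

  L≤U : ∀ y {p q} → L y p → U y q → p ≤ q
  L≤U y Lp Uq = <⇒≤ (L<U y Lp Uq)

  -- Openness leaves room above `q` for locatedness to decide, so an order goal reduces to refuting
  -- an upper bound, where classical reasoning is available.
  ≤ℝ-intro : ∀ x y → (∀ {q} → L x q → ¬ U y q) → x ≤ℝ y
  ≤ℝ-intro x y h Lq with L-open x Lq
  ... | r , q<r , Lr with located y q<r
  ...   | inj₁ Lyq = Lyq
  ...   | inj₂ Uyr = contradiction Uyr (h Lr)

  module UpToFactor (y : ℝ) (2≤y : fromℕ 2 ≤ℝ y) where

    U⇒0< : ∀ {Y} → U y Y → 0ℚ < Y
    U⇒0< UY = <-trans (positive⁻¹ 1ℚ) (L<U y (2≤y (*<* (ℤ.+<+ (s≤s (s≤s z≤n))))) UY)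

    -- b ≤ y a
    infix 4 _≼_
    record _≼_ (b a : ℕ) : Set where
      constructor bounded
      field bound : ∀ {Y} → U y Y → ι b ≤ Y * ι a
    open _≼_ public

    -- For each fixed `Y` the bound is a decidable inequality of rationals.
    ≼-stable : ∀ {b a} → ¬ ¬ b ≼ a → b ≼ a
    ≼-stable {b} {a} ¬¬b≼a = bounded λ {Y} UY →
      decidable-stable (ι b ≤? Y * ι a) (λ b≰Ya → ¬¬b≼a (λ b≼a → b≰Ya (bound b≼a UY)))

    ⋠⇒¬¬∃> : ∀ {b a} → ¬ b ≼ a → ¬ ¬ (∃[ Y ] U y Y × Y * ι a < ι b)
    ⋠⇒¬¬∃> b⋠a ∄ = b⋠a (bounded λ {Y} UY → ≮⇒≥ (λ Ya<b → ∄ (Y , UY , Ya<b)))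

    ≤-≼-trans : ∀ {c b a} → c ℕ.≤ b → b ≼ a → c ≼ a
    ≤-≼-trans {c} {b} c≤b b≼a = bounded λ UY → ≤-trans (ι-mono {c} {b} c≤b) (bound b≼a UY)

    ≼-≤-trans : ∀ {c b a} → c ≼ b → b ℕ.≤ a → c ≼ a
    ≼-≤-trans {c} {b} {a} c≼b b≤a = bounded λ {Y} UY → ≤-trans (bound c≼b UY)
      (*-monoˡ-≤-nonNeg Y {{nonNegative (<⇒≤ (U⇒0< UY))}} (ι-mono {b} {a} b≤a))

    *ʳ-≼ : ∀ k {b a} → b ≼ a → b ℕ.* k ≼ a ℕ.* k
    *ʳ-≼ k {b} {a} b≼a = bounded λ {Y} UY → begin
      ι (b ℕ.* k)       ≡⟨ ι-* b k ⟩
      ι b * ι k         ≤⟨ *-monoʳ-≤-nonNeg (ι k) {{nonNegative (0≤ι k)}} (bound b≼a UY) ⟩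
      Y * ι a * ι k     ≡⟨ *-assoc Y (ι a) (ι k) ⟩
      Y * (ι a * ι k)   ≡⟨ cong (Y *_) (ι-* a k) ⟨
      Y * ι (a ℕ.* k)   ∎
      where open ≤-Reasoning

    ≼-cancelʳ : ∀ k .{{_ : ℕ.NonZero k}} {b a} → b ℕ.* k ≼ a ℕ.* k → b ≼ a
    ≼-cancelʳ k {b} {a} bk≼ak = bounded λ {Y} UY → *-cancelʳ-≤-pos (ι k) {{positive (ι>0 k)}} (begin
      ι b * ι k         ≡⟨ ι-* b k ⟨
      ι (b ℕ.* k)       ≤⟨ bound bk≼ak UY ⟩
      Y * ι (a ℕ.* k)   ≡⟨ cong (Y *_) (ι-* a k) ⟩
      Y * (ι a * ι k)   ≡⟨ *-assoc Y (ι a) (ι k) ⟨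
      Y * ι a * ι k     ∎)
      where open ≤-Reasoning

    ≼⇒/≤ℝ : ∀ {b a} .{{_ : ℕ.NonZero a}} → b ≼ a → fromℚ (ℤ.+ b / a) ≤ℝ y
    ≼⇒/≤ℝ {b} {a} b≼a = ≤ℝ-intro (fromℚ (ℤ.+ b / a)) y λ {q} q<b/a Uq →
      <-irrefl refl (<-≤-trans
        (subst (q * ι a <_) (/-*-ι b a) (*-monoˡ-<-pos (ι a) {{positive (ι>0 a)}} q<b/a))
        (bound b≼a Uq))

    /≤ℝ⇒≼ : ∀ {b a} .{{_ : ℕ.NonZero a}} → fromℚ (ℤ.+ b / a) ≤ℝ y → b ≼ a
    /≤ℝ⇒≼ {b} {a} b/a≤y = bounded λ {Y} UY → subst (_≤ Y * ι a) (/-*-ι b a)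
      (*-monoʳ-≤-nonNeg (ι a) {{nonNegative (0≤ι a)}}
        (≮⇒≥ (λ Y<b/a → disjoint y (b/a≤y Y<b/a) UY)))

    -- If both alternatives fail, some `Y₁` and `Y₂` above `y` satisfy `Y₁ < p` and
    -- `Y₂ * m < p ^ i`, which leaves a rational below `p` that exceeds both arguments of the
    -- maximum.
    ≼-⊎-of-≤θₗ : ∀ i .{{_ : ℕ.NonZero i}} p .{{_ : ℕ.NonZero p}} m →
      fromℕ p ≤ℝ θₗ i y m → ¬ ¬ (p ≼ 1 ⊎ p ℕ.^ i ≼ m)
    ≼-⊎-of-≤θₗ i p m p≤θ neither =
      ⋠⇒¬¬∃> (λ p≼1 → neither (inj₁ p≼1)) λ (Y₁ , UY₁ , Y₁<p) →
      ⋠⇒¬¬∃> (λ p^i≼m → neither (inj₂ p^i≼m)) λ (Y₂ , UY₂ , Y₂m<p^i) →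
      ⊥-by UY₁ (subst (_< ι p) (*-identityʳ Y₁) Y₁<p) UY₂ (subst (Y₂ * ι m <_) (ι-^ p i) Y₂m<p^i)
      where
      ⊥-by : ∀ {Y₁ Y₂} → U y Y₁ → Y₁ < ι p → U y Y₂ → Y₂ * ι m < ι p ^ i → ⊥
      ⊥-by {Y₁} {Y₂} UY₁ Y₁<p UY₂ Y₂m<p^i
        with below-^ i (ι>0 p) (p≤p⊔q 0ℚ (Y₂ * ι m)) (⊔-lub-< (^-pos i (ι>0 p)) Y₂m<p^i)
      ... | q , 0<q , q<p , s<q^i with p≤θ (⊔-lub-< q<p Y₁<p)
      ...   | inj₁ Ly = <-irrefl refl (<-≤-trans (L<U y Ly UY₁) (p≤q⊔p q Y₁))
      ...   | inj₂ (inj₁ s<0) = <-asym s<0 (<-≤-trans 0<q (p≤p⊔q q Y₁))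
      ...   | inj₂ (inj₂ (r , s<r , a , b , c , d , La , Ub , c<m , m<d , r^i<min)) =
        <-irrefl refl (begin-strict
          r ^ i             <⟨ r^i<min ⟩
          -- The chosen point must lie between `a` and `b`, and `Y₂` may exceed `b`; hence `Y₂ ⊓ b`.
          minProd a b c d   ≤⟨ minProd-≤ (⊓-glb (L≤U y La UY₂) (L≤U y La Ub)) (p⊓q≤q Y₂ b)
                                 (<⇒≤ c<m) (<⇒≤ m<d) ⟩
          (Y₂ ⊓ b) * ι m    ≤⟨ *-monoʳ-≤-nonNeg (ι m) {{nonNegative (0≤ι m)}} (p⊓q≤p Y₂ b) ⟩
          Y₂ * ι m          ≤⟨ p≤q⊔p 0ℚ (Y₂ * ι m) ⟩
          0ℚ ⊔ Y₂ * ι m     <⟨ s<q^i ⟩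
          q ^ i             ≤⟨ ^-mono-≤ i (<⇒≤ 0<q) (≤-trans (p≤p⊔q q Y₁) (<⇒≤ s<r)) ⟩
          r ^ i             ∎)
        where open ≤-Reasoning

    -- Were `b * r` below `p` with `b` above `y` and `r` above the root of `m`, then
    -- `p ^ i ≤ b ^ i * m < (b * r) ^ i` would be absurd.
    ≤θᵤ-of-^≤ : ∀ i .{{_ : ℕ.NonZero i}} p m →
      (∀ {Y} → U y Y → ι p ^ i ≤ Y ^ i * ι m) → fromℕ p ≤ℝ θᵤ i y m
    ≤θᵤ-of-^≤ i p m p^i≤ = ≤ℝ-intro (fromℕ p) (θᵤ i y m)
      λ {q} q<p (a , b , c , d , La , Ub , Lc , (r , 0<r , r<d , m<r^i) , max<q) →
        let 0<b = U⇒0< Ub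
            br≤bd = *-monoˡ-≤-nonNeg b {{nonNegative (<⇒≤ 0<b)}} (<⇒≤ r<d)
            bd≤max = ≤-trans (p≤q⊔p (b * c) (b * d)) (p≤q⊔p (a * c ⊔ a * d) (b * c ⊔ b * d))
            br<p = <-trans (≤-<-trans (≤-trans br≤bd bd≤max) max<q) q<p
            0<br = subst (_< b * r) (*-zeroʳ b) (*-monoʳ-<-pos b {{positive 0<b}} 0<r)
            instance _ = positive (^-pos i 0<b)
        in <-irrefl refl (begin-strict
          (b * r) ^ i     <⟨ ^-mono-< i (<⇒≤ 0<br) br<p ⟩
          ι p ^ i         ≤⟨ p^i≤ Ub ⟩
          b ^ i * ι m     <⟨ *-monoʳ-<-pos (b ^ i) m<r^i ⟩
          b ^ i * r ^ i   ≡⟨ ^-distrib-* b r i ⟨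
          (b * r) ^ i     ∎)
      where open ≤-Reasoning

open Comparison

open import Defs renaming (_^_ to _^ℚ_)
open import Data.Empty using (⊥)
open import Data.Fin.Base using (Fin; toℕ; zero; suc)
open import Data.List.Base using (List; []; _∷_; length; lookup; take; drop)
open import Data.List.Properties using (take++drop≡id)
open import Data.List.Membership.Propositional.Properties using (∈-lookup)
open import Data.List.Relation.Binary.Permutation.Propositional using (↭-sym)
open import Data.List.Relation.Binary.Permutation.Propositional.Properties using (All-resp-↭)
open import Data.List.Relation.Unary.All as All using (All; []; _∷_)
import Data.List.Relation.Unary.All.Properties as All
open import Data.List.Relation.Unary.Linked as Linked using (Linked)
open import Data.List.Relation.Unary.Linked.Properties using (Linked⇒All)
open import Data.Nat.Base
open import Data.Nat.Coprimality using (coprime-/gcd; coprime-divisor)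
open import Data.Nat.DivMod
open import Data.Nat.Divisibility
open import Data.Nat.GCD using (gcd; gcd[m,n]∣m; gcd[m,n]∣n; gcd[m,n]≢0)
open import Data.Nat.Induction using (<-rec)
open import Data.Nat.ListAction using (product)
open import Data.Nat.ListAction.Properties using (product-++; product-↭; ∈⇒∣product; product≢0)
open import Data.Nat.Primality
open import Data.Nat.Primality.Factorisation
open import Data.Nat.Properties
open import Algebra.Properties.CommutativeSemigroup *-commutativeSemigroup using (xy∙z≈xz∙y)
open import Data.List.Relation.Unary.Sorted.TotalOrder ≤-totalOrder using (Sorted)
open import Data.List.Sort ≤-decTotalOrder using (sort; sort-↭; sort-↗)
open import Data.Product.Base using (∃; ∃-syntax; Σ-syntax; _×_; _,_; proj₂)
import Data.Rational.Base as ℚ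
import Data.Rational.Properties as ℚ
open import Data.Sum.Base as Sum using (_⊎_; inj₁; inj₂)
open import Function.Base using (_∘_)
open import Function.Bundles using (Equivalence)
open import Level using (0ℓ)
open import Relation.Binary.PropositionalEquality
open import Relation.Nullary using (¬_; yes; no; contradiction)
open import Relation.Nullary.Decidable using (decidable-stable)
open import Relation.Unary using (Pred; _⊆_)

-- Extremal elements of undecided predicates

Least : Pred ℕ 0ℓ → ℕ → Set
Least P k = P k × ∀ {m} → P m → k ≤ m

-- Without a least element, strong induction refutes `P` everywhere.
¬¬least : ∀ {P : Pred ℕ 0ℓ} {n} → P n → ¬ ¬ ∃ (Least P)
¬¬least {P} {n} Pn ∄ = <-rec (λ n → ¬ P n)
  (λ n rec Pn → ∄ (n , Pn , λ Pm → ≮⇒≥ (λ m<n → rec m<n Pm))) n Pn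

Greatest : Pred ℕ 0ℓ → ℕ → ℕ → Set
Greatest P t k = P k × k ≤ t × ∀ {m} → P m → m ≤ t → m ≤ k

-- The reflection `s ↦ t ∸ s` turns this into a least element.
¬¬greatest : ∀ {P : Pred ℕ 0ℓ} {n t} → n ≤ t → P n → ¬ ¬ ∃ (Greatest P t)
¬¬greatest {P} {n} {t} n≤t Pn ∄ =
  ¬¬least {λ s → P (t ∸ s)} {t ∸ n} (subst P (sym (m∸[m∸n]≡n n≤t)) Pn) λ (s , Ps , s-least) →
  ∄ (t ∸ s , Ps , m∸n≤m t s , λ {m} Pm m≤t →
    subst (_≤ t ∸ s) (m∸[m∸n]≡n m≤t)
      (∸-monoʳ-≤ t (s-least {t ∸ m} (subst P (sym (m∸[m∸n]≡n m≤t)) Pm))))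

-- Divisors, prime factorisations and rough numbers

∣-nonZero : ∀ {m n} .{{_ : NonZero n}} → m ∣ n → NonZero m
∣-nonZero {n = n} m∣n = ≢-nonZero λ { refl → ≢-nonZero⁻¹ n (0∣⇒≡0 m∣n) }

-- Take `u′ = gcd b u`; the quotient `b / u′` is coprime to `u / u′`, so it divides `v`.
∣-*-split : ∀ {b u v} .{{_ : NonZero u}} → b ∣ u * v →
  ∃[ u′ ] ∃[ v′ ] b ≡ u′ * v′ × u′ ∣ u × v′ ∣ v
∣-*-split {b} {u} {v} b∣uv = g , b / g , b≡ , gcd[m,n]∣n b u ,
  coprime-divisor (coprime-/gcd b u) (*-cancelʳ-∣ g
    (subst₂ _∣_ (sym (m/n*n≡m (gcd[m,n]∣m b u))) uv≡ b∣uv))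
  where
  g = gcd b u
  instance
    g≢0 : NonZero g
    g≢0 = ≢-nonZero (gcd[m,n]≢0 b u (inj₂ (≢-nonZero⁻¹ u)))
  b≡ : b ≡ g * (b / g)
  b≡ = trans (sym (m/n*n≡m (gcd[m,n]∣m b u))) (*-comm (b / g) g)
  uv≡ : u * v ≡ u / g * v * g
  uv≡ = trans (cong (_* v) (sym (m/n*n≡m (gcd[m,n]∣n b u)))) (xy∙z≈xz∙y (u / g) g v)

sortedFactorisation : ∀ n .{{_ : NonZero n}} →
  ∃[ ps ] All Prime ps × Sorted ps × n ≡ product ps
sortedFactorisation n with factorise n
... | record { factors = ps ; isFactorisation = n≡Πps ; factorsPrime = primes } =
  sort ps , All-resp-↭ (↭-sym (sort-↭ ps)) primes , sort-↗ ps ,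
  trans n≡Πps (sym (product-↭ (sort-↭ ps)))

product-prime≢0 : ∀ {ps} → All Prime ps → NonZero (product ps)
product-prime≢0 = product≢0 ∘ All.map prime⇒nonZero

rough-product : ∀ {p ps} → All Prime ps → All (p ≤_) ps → p Rough product ps
rough-product {p} primes p≤ (hasNonTrivialDivisor {divisor = d} d<p d∣Π)
  with factorise d {{nonTrivial⇒nonZero d}}
... | record { factors = [] ; isFactorisation = d≡1 } = nonTrivial⇒≢1 d≡1
... | record { factors = r ∷ rs ; isFactorisation = refl ; factorsPrime = r-prime ∷ rs-prime } =
  <⇒≱ d<p (≤-trans
    (All.lookup p≤ (factorisationHasAllPrimeFactors r-prime (∣-trans (m∣m*n (product rs)) d∣Π) primes))
    (m≤m*n r (product rs) {{product-prime≢0 rs-prime}}))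

-- Provides the rough cofactor for `𝒟-rough` when a product is cut just before the prime at position
-- `j`.
rough-drop : ∀ {ps} → All Prime ps → Sorted ps → (j : Fin (length ps)) →
  NonTrivial (product (drop (toℕ j) ps)) × lookup ps j Rough product (drop (toℕ j) ps)
rough-drop {p ∷ ps} primes@(p-prime ∷ ps-prime) sorted zero =
  n≢0∧m>1⇒m*n>1 p (product ps) {{product-prime≢0 ps-prime}} {{prime⇒nonTrivial p-prime}} ,
  rough-product primes (Linked⇒All ≤-trans ≤-refl sorted)
rough-drop (_ ∷ primes) sorted (suc j) = rough-drop primes (Linked.tail sorted) j

module Inclusions (y : ℝ) (2≤y : fromℕ 2 ≤ℝ y) where
  open UpToFactor y 2≤y

  -- Density expressed through gaps

  Straddle : Pred ℕ 0ℓ → ℕ → Set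
  Straddle A t = ∃[ a ] ∃[ b ] A a × A b × a ≤ t × t < b × b ≼ a

  -- Unlike Dense, this passes to larger sets without deciding membership.
  Gapless : ℕ → Pred ℕ 0ℓ → Set
  Gapless n A = ∀ {t} → 1 ≤ t → t < n → ¬ ¬ Straddle A t

  gapless-⊆ : ∀ {n A B} → A ⊆ B → Gapless n A → Gapless n B
  gapless-⊆ A⊆B gapless 1≤t t<n ¬s = gapless 1≤t t<n
    λ (a , b , Aa , Ab , rest) → ¬s (a , b , A⊆B Aa , A⊆B Ab , rest)

  -- The greatest element up to `t` and the least one beyond it are consecutive; `1` and `n`
  -- guarantee candidates for both.
  dense⇒gapless : ∀ {n A} → DenseFrom1To n y A → Gapless n A
  dense⇒gapless {n} {A} (dense , A1 , An) {t} 1≤t t<n ¬s =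
    ¬¬greatest {A} 1≤t A1 λ (a , Aa , a≤t , a-max) →
    ¬¬least {λ b → A b × t < b} (An , t<n) λ (b , (Ab , t<b) , b-min) →
    let instance _ = >-nonZero (a-max A1 1≤t)
        consec = Aa , Ab , ≤-<-trans a≤t t<b , λ {c} Ac a<c c<b →
                   <⇒≱ c<b (b-min (Ac , ≰⇒> (λ c≤t → <⇒≱ a<c (a-max Ac c≤t))))
    in ¬s (a , b , Aa , Ab , a≤t , t<b , /≤ℝ⇒≼ (dense consec))

  -- At `t = a` a straddling pair encloses `a` and `b`, so its ratio bounds theirs.
  gapless⇒dense : ∀ {n A} → (∀ {d} → A d → d ≤ n) → Gapless n A → Dense y A
  gapless⇒dense A≤n gapless {a} {b} (Aa , Ab , a<b , none) = ≼⇒/≤ℝ (≼-stable λ ¬b≼a →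
    gapless (>-nonZero⁻¹ a) (<-≤-trans a<b (A≤n Ab)) λ (a′ , b′ , Aa′ , Ab′ , a′≤a , a<b′ , b′≼a′) →
    ¬b≼a (≤-≼-trans (≮⇒≥ (none Ab′ a<b′)) (≼-≤-trans b′≼a′ a′≤a)))

  -- From `𝒟*` to `𝒟`

  𝒟*⇒𝒟 : ∀ i {n} → 𝒟* i y n → 𝒟 i y n
  𝒟-nonZero : ∀ i {n} → 𝒟 i y n → NonZero n

  𝒟-nonZero zero    n≢0              = n≢0
  𝒟-nonZero (suc i) (_ , _ , _ , Dn) = 𝒟-nonZero i Dn

  𝒟*⇒𝒟 zero    n≢0 = n≢0
  -- With `j = i` the divisors range over `𝒟* i`; dropping the cofactor and passing to `𝒟 i` only
  -- enlarges the set, which `Gapless` survives.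
  𝒟*⇒𝒟 (suc i) {n} n∈ with Equivalence.to (𝒟*-suc i) n∈ i ≤-refl
  ... | h@(_ , A1 , An) =
    gapless⇒dense (λ (d∣n , _) → ∣⇒≤ d∣n) (gapless-⊆ forget (dense⇒gapless h)) ,
    forget A1 , forget An
    where
    forget : ∀ {d} → (Σ[ d∣n ∈ d ∣ n ] 𝒟* i y d × 𝒟* (i ∸ i) y (quotient d∣n)) →
             d ∣ n × 𝒟 i y d
    forget (d∣n , Dd , _) = d∣n , 𝒟*⇒𝒟 i Dd
    instance _ = 𝒟-nonZero i (proj₂ (forget An))

  -- Rough cofactors of elements of `𝒟`

  𝒟-rough : ∀ i {p u v} .{{_ : NonZero u}} .{{_ : NonTrivial v}} → p Rough v → 𝒟 i y (u * v) →
    ∀ {Y} → ℝ.U y Y → ι p ^ℚ i ℚ.≤ Y ^ℚ i ℚ.* ι u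
  𝒟-rough zero {u = u} _ _ _ = ℚ.≤-trans (ι-mono {1} {u} (>-nonZero⁻¹ u))
    (ℚ.≤-reflexive (sym (ℚ.*-identityˡ (ι u))))
  𝒟-rough (suc i) {p} {u} {v} p-rough-v uv∈𝒟@(_ , _ , Auv) {Y} UY =
    -- The goal is a decidable inequality of rationals, so a least `b` may be assumed to exist.
    decidable-stable (_ ℚ.≤? _) λ ¬goal →
    ¬¬least {λ b → A b × ¬ b ∣ u} (Auv , uv∤u) λ (b , ((b∣uv , Db) , b∤u) , b-min) →
    let 1<b = ≤∧≢⇒< (>-nonZero⁻¹ b {{𝒟-nonZero i Db}}) (λ { refl → b∤u (1∣ u) })
        1+[b-1]≡b = suc-pred b {{𝒟-nonZero i Db}}
        1≤b-1 = s≤s⁻¹ (subst (1 <_) (sym 1+[b-1]≡b) 1<b)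
        b-1<uv = subst (_≤ u * v) (sym 1+[b-1]≡b) (∣⇒≤ b∣uv)
    -- With `t = b - 1` the upper element is at least `b`, and the lower one is less than `b`, hence
    -- divides `u` by minimality.
    in dense⇒gapless uv∈𝒟 1≤b-1 b-1<uv λ (a , b′ , Aa , _ , a≤b-1 , b-1<b′ , b′≼a) →
    let a∣u = decidable-stable (a ∣? u) λ a∤u →
                <⇒≱ (subst (a <_) 1+[b-1]≡b (s≤s a≤b-1)) (b-min (Aa , a∤u))
        b≼u = ≤-≼-trans (subst (_≤ b′) 1+[b-1]≡b b-1<b′) (≼-≤-trans b′≼a (∣⇒≤ a∣u))
    in ¬goal (step Db b∤u b≼u (∣-*-split b∣uv))
    where
    A : Pred ℕ 0ℓ
    A d = d ∣ u * v × 𝒟 i y d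
    instance
      _ = nonTrivial⇒nonZero v
      _ = m*n≢0 u v
    uv∤u : ¬ u * v ∣ u
    uv∤u uv∣u = <⇒≱ (m<m*n u v (nonTrivial⇒n>1 v)) (∣⇒≤ uv∣u)
    step : ∀ {b} → 𝒟 i y b → ¬ b ∣ u → b ≼ u →
      ∃[ u′ ] ∃[ v′ ] b ≡ u′ * v′ × u′ ∣ u × v′ ∣ v → ι p ^ℚ suc i ℚ.≤ Y ^ℚ suc i ℚ.* ι u
    step Db b∤u b≼u (u′ , v′ , refl , u′∣u , v′∣v) = begin
      ι p ℚ.* ι p ^ℚ i               ≤⟨ *-mono-≤₀ (0≤ι p) (ι-mono {p} {v′} (rough⇒≤ p-rough-v′))
                                          (^-nonNeg i (0≤ι p)) (𝒟-rough i {u = u′} p-rough-v′ Db UY) ⟩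
      ι v′ ℚ.* (Y ^ℚ i ℚ.* ι u′)     ≡⟨ ℚ.*-comm (ι v′) (Y ^ℚ i ℚ.* ι u′) ⟩
      Y ^ℚ i ℚ.* ι u′ ℚ.* ι v′       ≡⟨ ℚ.*-assoc (Y ^ℚ i) (ι u′) (ι v′) ⟩
      Y ^ℚ i ℚ.* (ι u′ ℚ.* ι v′)     ≡⟨ cong (Y ^ℚ i ℚ.*_) (ι-* u′ v′) ⟨
      Y ^ℚ i ℚ.* ι (u′ * v′)         ≤⟨ ℚ.*-monoˡ-≤-nonNeg (Y ^ℚ i) (bound b≼u UY) ⟩
      Y ^ℚ i ℚ.* (Y ℚ.* ι u)         ≡⟨ ℚ.*-assoc (Y ^ℚ i) Y (ι u) ⟨
      Y ^ℚ i ℚ.* Y ℚ.* ι u           ≡⟨ cong (ℚ._* ι u) (ℚ.*-comm (Y ^ℚ i) Y) ⟩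
      Y ℚ.* Y ^ℚ i ℚ.* ι u           ∎
      where
      open ℚ.≤-Reasoning
      instance
        _ = ℚ.nonNegative (^-nonNeg i (ℚ.<⇒≤ (U⇒0< UY)))
        u′≢0 : NonZero u′
        u′≢0 = ∣-nonZero u′∣u
        v′≢0 : NonZero v′
        v′≢0 = ∣-nonZero v′∣v
        v′-nonTrivial : NonTrivial v′
        v′-nonTrivial = n>1⇒nonTrivial (≤∧≢⇒< (>-nonZero⁻¹ v′)
          (λ { refl → b∤u (subst (_∣ u) (sym (*-identityʳ u′)) u′∣u) }))
      p-rough-v′ : p Rough v′
      p-rough-v′ = rough∧∣⇒rough p-rough-v v′∣v

  -- Splitting products whose factors obey `θₗ`

  -- Every n ∈ ℬ (θₗ i y) lies in 𝒢 i; the factors need not be prime, nor occur in increasing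
  -- order.
  data 𝒢 (i : ℕ) : ℕ → Set where
    1∈𝒢    : 𝒢 i 1
    extend : ∀ {n p} .{{_ : NonZero p}} → 𝒢 i n → ¬ ¬ (p ≼ 1 ⊎ p ^ i ≼ n) → 𝒢 i (n * p)

  𝒢-nonZero : ∀ {i n} → 𝒢 i n → NonZero n
  𝒢-nonZero 1∈𝒢 = _
  𝒢-nonZero (extend {n} {p} n∈𝒢 _) = m*n≢0 n p {{𝒢-nonZero n∈𝒢}}

  -- As `p ≥ 1`, a smaller exponent weakens the condition. This puts an element of `𝒢 (suc (j + c))`
  -- into both `𝒢 j` and `𝒢 c`, as the two trivial splittings require.
  𝒢-antitone : ∀ {i j n} → j ≤ i → 𝒢 i n → 𝒢 j n
  𝒢-antitone j≤i 1∈𝒢 = 1∈𝒢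
  𝒢-antitone j≤i (extend {n} {p} n∈𝒢 ok) = extend (𝒢-antitone j≤i n∈𝒢) λ ¬ok → ok λ
    { (inj₁ p≼1)   → ¬ok (inj₁ p≼1)
    ; (inj₂ p^i≼n) → ¬ok (inj₂ (≤-≼-trans (^-monoʳ-≤ p j≤i) p^i≼n)) }

  Split : ℕ → ℕ → ℕ → Pred ℕ 0ℓ
  Split j c n d = ∃[ e ] n ≡ e * d × 𝒢 j d × 𝒢 c e

  module _ {j c n p : ℕ} .{{_ : NonZero p}} where
    -- Extending the cofactor takes `p ^ c ≼ e`; multiplied by `d`, this becomes a condition on `d`
    -- and `n` alone.
    split-*ˡ : ∀ {d} → p ≼ 1 ⊎ p ^ c * d ≼ n → Split j c n d → Split j c (n * p) d
    split-*ˡ {d} ok (e , refl , d∈ , e∈) =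
      e * p , xy∙z≈xz∙y e d p , d∈ , extend e∈ (contradiction (Sum.map₂ (≼-cancelʳ d) ok))
      where instance _ = 𝒢-nonZero d∈

    split-*ʳ : ∀ {d} → p ≼ 1 ⊎ p ^ j ≼ d → Split j c n d → Split j c (n * p) (d * p)
    split-*ʳ {d} ok (e , refl , d∈ , e∈) =
      e , *-assoc e d p , extend d∈ (contradiction ok) , e∈

  1∈split : ∀ {j c n} → 𝒢 (suc (j + c)) n → Split j c n 1
  1∈split {j} {c} {n} n∈ = n , sym (*-identityʳ n) , 1∈𝒢 , 𝒢-antitone (m≤n⇒m≤1+n (m≤n+m c j)) n∈

  n∈split : ∀ {j c n} → 𝒢 (suc (j + c)) n → Split j c n n
  n∈split {j} {c} {n} n∈ = 1 , sym (*-identityˡ n) , 𝒢-antitone (m≤n⇒m≤1+n (m≤m+n j c)) n∈ , 1∈𝒢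

  gapless-split : ∀ j c {n} → 𝒢 (suc (j + c)) n → Gapless n (Split j c n)
  gapless-split j c 1∈𝒢 1≤t t<1 = contradiction 1≤t (<⇒≱ t<1)
  gapless-split j c (extend {n} {p} n∈ ok) {t} 1≤t t<np ¬s = ok λ
    { (inj₁ p≼1)   → small p≼1
    ; (inj₂ p^i≼n) → large p^i≼n }
    where
    A : Pred ℕ 0ℓ
    A = Split j c n
    A1 : A 1
    A1 = 1∈split n∈
    An : A n
    An = n∈split n∈

    -- Here `d` and `d * p` both survive for every `d`: the pair `1`, `p` serves for `t < p`, and a
    -- pair around `t / p` scaled by `p` serves otherwise.
    small : p ≼ 1 → ⊥
    small p≼1 with p ≤? t
    ... | no  p≰t = ¬s (1 , p , split-*ˡ (inj₁ p≼1) A1 ,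
      subst (Split j c (n * p)) (*-identityˡ p) (split-*ʳ (inj₁ p≼1) A1) , 1≤t , ≰⇒> p≰t , p≼1)
    ... | yes p≤t = gapless-split j c n∈ (m≥n⇒m/n>0 p≤t) (m<n*o⇒m/o<n t<np)
      λ (a , b , Aa , Ab , a≤t/p , t/p<b , b≼a) →
      ¬s (a * p , b * p , split-*ʳ (inj₁ p≼1) Aa , split-*ʳ (inj₁ p≼1) Ab ,
          ≤-trans (*-monoˡ-≤ p a≤t/p) (m/n*n≤m t p) ,
          ≰⇒> (λ bp≤t → <⇒≱ t/p<b (subst (_≤ t / p) (m*n/n≡m b p) (/-monoˡ-≤ p bp≤t))) ,
          *ʳ-≼ p b≼a)

    -- The divisors d of n that remain admissible for n * p are those with p ^ c * d ≼ n, and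
    -- those that may be multiplied by p are those with p ^ j ≼ d.  The first kind reaches up
    -- to n / p ^ c and the second kind starts below p ^ j, so that the two overlap, up to
    -- a factor y, when p ^ (1 + j + c) ≼ n.
    large : p ^ suc (j + c) ≼ n → ⊥
    large p^i≼n =
      ¬¬greatest {λ d → A d × p ^ c * d ≼ n} 1≤t (A1 , low1) λ (d₀ , (Ad₀ , low-d₀) , d₀≤t , d₀-max) →
      ¬¬least {λ d → A d × p ^ j ≼ d × t < d * p} (An , high-n , t<np)
        λ (d₁ , (Ad₁ , high-d₁ , t<d₁p) , d₁-min) →
      low-reach Ad₀ low-d₀ d₀≤t d₀-max λ n≤ →
      high-reach Ad₁ high-d₁ t<d₁p d₁-min λ d₁≤ →
      ¬s (d₀ , d₁ * p , split-*ˡ (inj₂ low-d₀) Ad₀ , split-*ʳ (inj₂ high-d₁) Ad₁ , d₀≤t , t<d₁p ,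
          bridge n≤ d₁≤)
      where
      instance
        p^c≢0 : NonZero (p ^ c)
        p^c≢0 = m^n≢0 p c
      low1 : p ^ c * 1 ≼ n
      low1 = ≤-≼-trans (≤-trans (≤-reflexive (*-identityʳ (p ^ c)))
                         (^-monoʳ-≤ p (m≤n⇒m≤1+n (m≤n+m c j)))) p^i≼n
      high-n : p ^ j ≼ n
      high-n = ≤-≼-trans (^-monoʳ-≤ p (m≤n⇒m≤1+n (m≤m+n j c))) p^i≼n

      -- Otherwise the gap at `d₀` yields `b > d₀` with `b ≼ d₀`, again of the first kind because
      -- `p ^ c * d₀ ≤ n`. Maximality forces `t < b`, so `d₀` and `b` straddle `t`.
      low-reach : ∀ {d₀} → A d₀ → p ^ c * d₀ ≼ n → d₀ ≤ t →
        (∀ {d} → A d × p ^ c * d ≼ n → d ≤ t → d ≤ d₀) → ¬ ¬ n ≤ p ^ c * d₀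
      low-reach {d₀} Ad₀@(e , n≡ed₀ , d₀∈ , _) low-d₀ d₀≤t d₀-max n≰ =
        gapless-split j c n∈ (>-nonZero⁻¹ d₀ {{𝒢-nonZero d₀∈}}) d₀<n
        λ (a , b , Aa , Ab , a≤d₀ , d₀<b , b≼a) →
        let b≼d₀ = ≼-≤-trans b≼a a≤d₀
            low-b = ≼-≤-trans (subst₂ _≼_ (*-comm b (p ^ c)) (*-comm d₀ (p ^ c))
                                (*ʳ-≼ (p ^ c) b≼d₀)) (≰⇒≥ n≰)
            t<b = ≰⇒> λ b≤t → <⇒≱ d₀<b (d₀-max (Ab , low-b) b≤t)
        in ¬s (d₀ , b , split-*ˡ (inj₂ low-d₀) Ad₀ , split-*ˡ (inj₂ low-b) Ab , d₀≤t , t<b , b≼d₀)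
        where
        d₀<n : d₀ < n
        d₀<n = ≤-<-trans (m≤n*m d₀ (p ^ c)) (≰⇒> n≰)

      -- Dually, the gap at `d₁ - 1` yields `a < d₁` with `d₁ ≼ a`, again of the second kind because
      -- `p ^ j ≤ d₁`. Minimality forces `a * p ≤ t`, so `a * p` and `d₁ * p` straddle `t`.
      high-reach : ∀ {d₁} → A d₁ → p ^ j ≼ d₁ → t < d₁ * p →
        (∀ {d} → A d × p ^ j ≼ d × t < d * p → d₁ ≤ d) → ¬ ¬ d₁ ≤ p ^ j
      high-reach {d₁} Ad₁@(e , n≡ed₁ , d₁∈ , e∈) high-d₁ t<d₁p d₁-min d₁≰ =
        gapless-split j c n∈ 1≤d₁-1 d₁-1<n
        λ (a , b , Aa , Ab , a≤d₁-1 , d₁-1<b , b≼a) →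
        let d₁≼a = ≤-≼-trans (subst (_≤ b) 1+[d₁-1]≡d₁ d₁-1<b) b≼a
            high-a = ≤-≼-trans (≰⇒≥ d₁≰) d₁≼a
            ap≤t = ≮⇒≥ λ t<ap →
              <⇒≱ (subst (a <_) 1+[d₁-1]≡d₁ (s≤s a≤d₁-1)) (d₁-min (Aa , high-a , t<ap))
        in ¬s (a * p , d₁ * p , split-*ʳ (inj₂ high-a) Aa , split-*ʳ (inj₂ high-d₁) Ad₁ ,
               ap≤t , t<d₁p , *ʳ-≼ p d₁≼a)
        where
        1+[d₁-1]≡d₁ = suc-pred d₁ {{𝒢-nonZero d₁∈}}
        1≤d₁-1 : 1 ≤ pred d₁
        1≤d₁-1 = s≤s⁻¹ (subst (1 <_) (sym 1+[d₁-1]≡d₁) (≤-<-trans (m^n>0 p j) (≰⇒> d₁≰)))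
        d₁-1<n : pred d₁ < n
        d₁-1<n = subst (_≤ n) (sym 1+[d₁-1]≡d₁)
          (subst (d₁ ≤_) (sym n≡ed₁) (m≤n*m d₁ e {{𝒢-nonZero e∈}}))

      -- From `p ^ suc j * p ^ c ≼ n ≤ p ^ c * d₀` the factor `p ^ c` cancels.
      bridge : ∀ {d₀ d₁} → n ≤ p ^ c * d₀ → d₁ ≤ p ^ j → d₁ * p ≼ d₀
      bridge {d₀} {d₁} n≤ d₁≤ = ≤-≼-trans
        (≤-trans (*-monoˡ-≤ p d₁≤) (≤-reflexive (*-comm (p ^ j) p)))
        (≼-cancelʳ (p ^ c) (subst₂ _≼_
          (^-distribˡ-+-* p (suc j) c) (*-comm (p ^ c) d₀) (≼-≤-trans p^i≼n n≤)))

  𝒢⇒𝒟* : ∀ i {n} → 𝒢 i n → 𝒟* i y n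
  𝒢⇒𝒟* = <-rec (λ i → ∀ {n} → 𝒢 i n → 𝒟* i y n) λ
    { zero    rec n∈ → 𝒢-nonZero n∈
    ; (suc i) rec {n} n∈ → Equivalence.from (𝒟*-suc i) λ j j≤i →
        let instance _ = 𝒢-nonZero n∈
            n∈′ = subst (λ k → 𝒢 (suc k) n) (sym (m+[n∸m]≡n j≤i)) n∈
            member : ∀ {d} → Split j (i ∸ j) n d →
                     Σ[ d∣n ∈ d ∣ n ] 𝒟* j y d × 𝒟* (i ∸ j) y (quotient d∣n)
            member = λ (e , n≡ed , d∈ , e∈) →
              divides e n≡ed , rec (s≤s j≤i) d∈ , rec (s≤s (m∸n≤m i j)) e∈
        in gapless⇒dense (λ (d∣n , _) → ∣⇒≤ d∣n) (gapless-⊆ member (gapless-split j (i ∸ j) n∈′)) ,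
           member (1∈split n∈′) , member (n∈split n∈′) }

  -- `m` accumulates the factors already treated, so the bounds on the tail still refer to the full
  -- preceding product.
  𝒢-of-ℬ : ∀ i .{{_ : NonZero i}} {m} ps → 𝒢 i m → All Prime ps →
    (∀ (j : Fin (length ps)) → fromℕ (lookup ps j) ≤ℝ θₗ i y (m * product (take (toℕ j) ps))) →
    𝒢 i (m * product ps)
  𝒢-of-ℬ i {m} [] m∈ _ _ = subst (𝒢 i) (sym (*-identityʳ m)) m∈
  𝒢-of-ℬ i {m} (p ∷ ps) m∈ (p-prime ∷ primes) ≤θ =
    subst (𝒢 i) (*-assoc m p (product ps)) (𝒢-of-ℬ i ps mp∈ primes λ j →
      subst (λ k → fromℕ (lookup ps j) ≤ℝ θₗ i y k)
        (sym (*-assoc m p (product (take (toℕ j) ps)))) (≤θ (suc j)))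
    where
    instance _ = prime⇒nonZero p-prime
    mp∈ : 𝒢 i (m * p)
    mp∈ = extend m∈ (≼-⊎-of-≤θₗ i p m
      (subst (λ k → fromℕ p ≤ℝ θₗ i y k) (*-identityʳ m) (≤θ zero)))

-- Assembly of the chain of inclusions

theorem2 : ∀ (i : ℕ) .{{_ : NonZero i}} (y : ℝ) → fromℕ 2 ≤ℝ y →
    (𝒮 y ⊆ ℬ (θₗ i y)) × (ℬ (θₗ i y) ⊆ 𝒟* i y) × (𝒟* i y ⊆ 𝒟 i y) × (𝒟 i y ⊆ ℬ (θᵤ i y))
theorem2 i y 2≤y = 𝒮⊆ℬ , ℬ⊆𝒟* , 𝒟*⇒𝒟 i , 𝒟⊆ℬ
  where
  open UpToFactor y 2≤y using (≤θᵤ-of-^≤)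
  open Inclusions y 2≤y

  𝒮⊆ℬ : 𝒮 y ⊆ ℬ (θₗ i y)
  𝒮⊆ℬ {n} (n≢0 , smooth) with sortedFactorisation n {{n≢0}}
  ... | ps , primes , sorted , refl = ps , primes , sorted , refl , λ j L<p →
    -- Each prime is at most `y`, the first argument of the maximum in `θₗ`.
    inj₁ (smooth (All.lookup primes (∈-lookup {xs = ps} j)) (∈⇒∣product (∈-lookup {xs = ps} j)) L<p)

  ℬ⊆𝒟* : ℬ (θₗ i y) ⊆ 𝒟* i y
  ℬ⊆𝒟* (ps , primes , _ , refl , ≤θ) = subst (𝒟* i y) (*-identityˡ (product ps))
    (𝒢⇒𝒟* i (𝒢-of-ℬ i ps 1∈𝒢 primes λ j →
      subst (λ k → fromℕ (lookup ps j) ≤ℝ θₗ i y k)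
        (sym (*-identityˡ (product (take (toℕ j) ps)))) (≤θ j)))

  𝒟⊆ℬ : 𝒟 i y ⊆ ℬ (θᵤ i y)
  𝒟⊆ℬ {n} n∈𝒟 with sortedFactorisation n {{𝒟-nonZero i n∈𝒟}}
  ... | ps , primes , sorted , refl = ps , primes , sorted , refl , λ j →
    let u , v = product (take (toℕ j) ps) , product (drop (toℕ j) ps)
        uv≡ = trans (sym (product-++ (take (toℕ j) ps) (drop (toℕ j) ps)))
                (cong product (take++drop≡id (toℕ j) ps))
        v-nonTrivial , rough = rough-drop primes sorted j
        instance
          _ = v-nonTrivial
          _ = product-prime≢0 (All.take⁺ (toℕ j) primes)
    in ≤θᵤ-of-^≤ i (lookup ps j) u (𝒟-rough i {u = u} rough (subst (𝒟 i y) (sym uv≡) n∈𝒟))
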